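{- Let $M\subseteq N$ and let $m\in\mathcal{K}(N)$ be the lifting of $r\in\mathcal{K}(M)$ to $N$, that is, $m(S)=r(S\cap M)$ for every $S\subseteq N$. Then $m$ is extreme in $\mathcal{K}(N)$ if and only if $r$ is extreme in $\mathcal{K}(M)$.
   Context: $N$ is a finite set with $|N|\ge 2$ and $\mathcal{P}(N)$ is its power set. $\mathbb{R}^{\mathcal{P}(N)}$ is the space of functions $m:\mathcal{P}(N)\to\mathbb{R}$ with scalar product $\langle m,u\rangle=\sum_{A\subseteq N}m(A)u(A)$. A function $m$ is supermodular if $m(A)+m(B)\le m(A\cup B)+m(A\cap B)$ for all $A,B\subseteq N$; $\mathcal{K}(N)$ is the cone of supermodular functions. A face of a convex cone $K\subseteq\mathbb{R}^{\mathcal{P}(N)}$ is a set $\{m\in K: k=\langle m,v\rangle\}$, where $v\in\mathbb{R}^{\mathcal{P}(N)}$, $k\in\mathbb{R}$ satisfy $k\le\langle m,v\rangle$ for all $m\in K$. The non-empty faces of $\mathcal{K}(N)$ form a lattice under inclusion with least element the space of modular functions $\mathcal{K}(N)\cap(-\mathcal{K}(N))$. A function $m\in\mathcal{K}(N)$ is extreme in $\mathcal{K}(N)$ if the smallest face of $\mathcal{K}(N)$ containing $m$ is an atom of this lattice. The same definitions are used for other finite sets in place of $N$. -}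

module Defs where

open import Algebra.Structures using (IsCommutativeRing)
open import Data.Empty using (⊥-elim-irr)
open import Data.Fin.Base using (zero)
open import Data.Fin.Subset using (Subset; inside; outside)
  renaming (_∈_ to _∈ˢ_; _⊆_ to _⊆ˢ_; _∪_ to _∪ˢ_; _∩_ to _∩ˢ_)
open import Data.Fin.Subset.Properties
  using (out⊆; in⊆in; drop-∷-⊆; p∩q⊆p; p∩q⊆q; x∈p∪q⁻)
open import Data.Irrelevant using ([_])
open import Data.List.Base using (List; []; _∷_; _++_; map; foldr)
import Data.List.Membership.Propositional as List
open import Data.List.Membership.Propositional.Properties
  using (∈-++⁺ˡ; ∈-++⁺ʳ; ∈-map⁺; ∈-map⁻)
open import Data.List.Relation.Binary.Disjoint.Propositional using (Disjoint)
open import Data.List.Relation.Unary.All using ([])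
open import Data.List.Relation.Unary.Any using (here)
open import Data.List.Relation.Unary.AllPairs using ([]; _∷_)
open import Data.List.Relation.Unary.Unique.Propositional using (Unique)
open import Data.List.Relation.Unary.Unique.Propositional.Properties
  using (map⁺; ++⁺)
open import Data.Nat.Base using (ℕ)
open import Data.Product.Base using (∃; _×_; _,_; proj₁)
open import Data.Refinement using (Refinement; _,_; value; value-injective)
open import Data.Sum.Base as Sum using (_⊎_)
open import Data.Vec.Base using ([]; _∷_; here)
open import Data.Vec.Properties using (∷-injectiveʳ)
open import Level using (_⊔_) renaming (suc to lsuc)
open import Relation.Binary.Bundles using (Poset)
import Relation.Binary.Construct.On as On
open import Relation.Binary.Core using (Rel)
open import Relation.Binary.Definitions using (Minimum)
open import Relation.Binary.PropositionalEquality.Core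
  using (_≡_; refl; cong)
open import Relation.Binary.Structures using (IsTotalOrder)
open import Relation.Nullary.Negation.Core using (¬_)
open import Relation.Unary using (Pred; _∈_; _⊆_; Satisfiable)
open import Relation.Unary.Relation.Binary.Subset using (⊆-poset)

-- The classical axiomatisation of ℝ, which determines it up to isomorphism.

record CompleteOrderedField c ℓ₁ ℓ₂ : Set (lsuc (c ⊔ ℓ₁ ⊔ ℓ₂)) where
  infixl 7 _*_
  infixl 6 _+_
  infix  8 -_
  infix  4 _≈_ _≤_
  field
    Carrier           : Set c
    _≈_               : Rel Carrier ℓ₁
    _≤_               : Rel Carrier ℓ₂
    _+_ _*_           : Carrier → Carrier → Carrier
    -_                : Carrier → Carrier
    0# 1#             : Carrier
    isCommutativeRing : IsCommutativeRing _≈_ _+_ _*_ -_ 0# 1#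
    0≉1               : ¬ 0# ≈ 1#
    inverse           : ∀ x → ¬ x ≈ 0# → ∃ λ y → x * y ≈ 1#
    isTotalOrder      : IsTotalOrder _≈_ _≤_
    +-monoˡ-≤         : ∀ z {x y} → x ≤ y → x + z ≤ y + z
    *-nonNegative     : ∀ {x y} → 0# ≤ x → 0# ≤ y → 0# ≤ x * y

  UpperBound : Pred Carrier (c ⊔ ℓ₁ ⊔ ℓ₂) → Pred Carrier (c ⊔ ℓ₁ ⊔ ℓ₂)
  UpperBound P b = ∀ {x} → P x → x ≤ b

  field
    supremum : ∀ P → Satisfiable P → Satisfiable (UpperBound P) →
               ∃ λ s → s ∈ UpperBound P × (∀ {b} → b ∈ UpperBound P → s ≤ b)

-- All finite ground sets are subsets X of some Fin n. The bound A ⊆ X is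
-- irrelevant so that elements of the power set 𝒫 X are propositionally
-- equal as soon as the underlying subsets are, and every function on 𝒫 X
-- is automatically well defined.

module _ {n : ℕ} where

  𝒫 : Subset n → Set
  𝒫 X = Refinement (Subset n) (λ A → A ⊆ˢ X)

  infixr 7 _∩_
  infixr 6 _∪_

  _∪_ : ∀ {X} → 𝒫 X → 𝒫 X → 𝒫 X
  (A , [ A⊆X ]) ∪ (B , [ B⊆X ]) =
    A ∪ˢ B , [ (λ x∈ → Sum.[ A⊆X , B⊆X ]′ (x∈p∪q⁻ A B x∈)) ]

  _∩_ : ∀ {X} → 𝒫 X → 𝒫 X → 𝒫 X
  (A , [ A⊆X ]) ∩ (B , _) = A ∩ˢ B , [ (λ x∈ → A⊆X (p∩q⊆p A B x∈)) ]

  trace : ∀ {X} (Y : Subset n) → 𝒫 X → 𝒫 Y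
  trace Y (S , _) = S ∩ˢ Y , [ (λ x∈ → p∩q⊆q S Y x∈) ]

out : ∀ {n s} {X : Subset n} → 𝒫 X → 𝒫 (s ∷ X)
out (A , [ A⊆X ]) = outside ∷ A , [ out⊆ A⊆X ]

in₀ : ∀ {n} {X : Subset n} → 𝒫 X → 𝒫 (inside ∷ X)
in₀ (A , [ A⊆X ]) = inside ∷ A , [ in⊆in A⊆X ]

subsets : ∀ {n} (X : Subset n) → List (𝒫 X)
subsets []            = ([] , [ (λ x∈ → x∈) ]) ∷ []
subsets (outside ∷ X) = map out (subsets X)
subsets (inside  ∷ X) = map out (subsets X) ++ map in₀ (subsets X)

subsets-complete : ∀ {n} (X : Subset n) (A : 𝒫 X) → A List.∈ subsets X
subsets-complete [] ([] , _) = here refl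
subsets-complete (outside ∷ X) (outside ∷ A , [ A⊆X ]) =
  ∈-map⁺ out (subsets-complete X (A , [ drop-∷-⊆ A⊆X ]))
subsets-complete (outside ∷ X) (inside ∷ A , [ A⊆X ]) = ⊥-elim-irr (0∉ (A⊆X here))
  where
  0∉ : ¬ (zero ∈ˢ outside ∷ X)
  0∉ ()
subsets-complete (inside ∷ X) (outside ∷ A , [ A⊆X ]) =
  ∈-++⁺ˡ (∈-map⁺ out (subsets-complete X (A , [ drop-∷-⊆ A⊆X ])))
subsets-complete (inside ∷ X) (inside ∷ A , [ A⊆X ]) =
  ∈-++⁺ʳ (map out (subsets X))
    (∈-map⁺ in₀ (subsets-complete X (A , [ drop-∷-⊆ A⊆X ])))

subsets-unique : ∀ {n} (X : Subset n) → Unique (subsets X)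
subsets-unique []            = [] ∷ []
subsets-unique (outside ∷ X) = map⁺ out-injective (subsets-unique X)
  where
  out-injective : ∀ {A B : 𝒫 X} → out {s = outside} A ≡ out B → A ≡ B
  out-injective eq = value-injective (∷-injectiveʳ (cong value eq))
subsets-unique (inside ∷ X)  =
  ++⁺ (map⁺ out-injective (subsets-unique X))
      (map⁺ in-injective (subsets-unique X)) disjoint
  where
  out-injective : ∀ {A B : 𝒫 X} → out {s = inside} A ≡ out B → A ≡ B
  out-injective eq = value-injective (∷-injectiveʳ (cong value eq))
  in-injective : ∀ {A B : 𝒫 X} → in₀ A ≡ in₀ B → A ≡ B
  in-injective eq = value-injective (∷-injectiveʳ (cong value eq))
  out≢in : ∀ {A B : 𝒫 X} → ¬ (out A ≡ in₀ B)
  out≢in ()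
  disjoint : Disjoint (map out (subsets X)) (map in₀ (subsets X))
  disjoint (p , q) with ∈-map⁻ out p | ∈-map⁻ in₀ q
  ... | A , _ , refl | B , _ , eq = out≢in {A} {B} eq

module _ {a ℓ₁ ℓ₂} (P : Poset a ℓ₁ ℓ₂) where
  open Poset P

  IsAtom : Pred Carrier (a ⊔ ℓ₁ ⊔ ℓ₂)
  IsAtom a = ∃ λ ⊥ → Minimum _≤_ ⊥ × ¬ a ≈ ⊥ ×
                     (∀ b → b ≤ a → b ≈ ⊥ ⊎ b ≈ a)

module SetFunctions {c ℓ₁ ℓ₂} (ℝ : CompleteOrderedField c ℓ₁ ℓ₂) where
  open CompleteOrderedField ℝ

  module _ {n : ℕ} where

    ℝ^𝒫 : Subset n → Set c
    ℝ^𝒫 X = 𝒫 X → Carrier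

    ⟨_,_⟩ : ∀ {X} → ℝ^𝒫 X → ℝ^𝒫 X → Carrier
    ⟨_,_⟩ {X} m u = foldr _+_ 0# (map (λ A → m A * u A) (subsets X))

    𝒦 : (X : Subset n) → Pred (ℝ^𝒫 X) ℓ₂
    𝒦 X m = ∀ (A B : 𝒫 X) → m A + m B ≤ m (A ∪ B) + m (A ∩ B)

    -- A face is given by a pair (v , k) that exposes it. Different pairs may
    -- expose the same set, so faces are compared through ⟦_⟧ only.
    record Face {ℓ} {X : Subset n} (K : Pred (ℝ^𝒫 X) ℓ) : Set (c ⊔ ℓ ⊔ ℓ₂) where
      field
        v     : ℝ^𝒫 X
        k     : Carrier
        valid : ∀ {m} → m ∈ K → k ≤ ⟨ m , v ⟩

    ⟦_⟧ : ∀ {ℓ X} {K : Pred (ℝ^𝒫 X) ℓ} → Face K → Pred (ℝ^𝒫 X) (ℓ ⊔ ℓ₁)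
    ⟦_⟧ {K = K} F m = m ∈ K × k ≈ ⟨ m , v ⟩
      where open Face F

    NonEmptyFace : ∀ {ℓ X} → Pred (ℝ^𝒫 X) ℓ → Set (c ⊔ ℓ ⊔ ℓ₁ ⊔ ℓ₂)
    NonEmptyFace K = ∃ λ (F : Face K) → Satisfiable ⟦ F ⟧

    faces : ∀ {ℓ X} → Pred (ℝ^𝒫 X) ℓ → Poset _ _ _
    faces {ℓ} {X} K =
      On.poset (⊆-poset (ℝ^𝒫 X) (ℓ ⊔ ℓ₁)) (λ (F : NonEmptyFace K) → ⟦ proj₁ F ⟧)

    IsSmallestFaceContaining : ∀ {ℓ X} {K : Pred (ℝ^𝒫 X) ℓ} →
                               ℝ^𝒫 X → Face K → Set _
    IsSmallestFaceContaining {K = K} m F =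
      m ∈ ⟦ F ⟧ × (∀ (G : Face K) → m ∈ ⟦ G ⟧ → ⟦ F ⟧ ⊆ ⟦ G ⟧)

    Extreme : (X : Subset n) → Pred (ℝ^𝒫 X) _
    Extreme X m =
      m ∈ 𝒦 X ×
      ∃ λ (F : NonEmptyFace (𝒦 X)) →
        IsSmallestFaceContaining m (proj₁ F) × IsAtom (faces (𝒦 X)) F

    _IsLiftingOf_ : ∀ {N M} → ℝ^𝒫 N → ℝ^𝒫 M → Set _
    _IsLiftingOf_ {N} {M} m r = ∀ (S : 𝒫 N) → m S ≈ r (trace M S)

{-# OPTIONS --safe #-}

-- The smallest face of 𝒦 N containing m consists of the supermodular
-- functions x that satisfy with equality all the inequalities that m does
-- (Tight m ⊆ Tight x); it is exposed by the sum of these inequalities. So m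
-- is extreme iff it is not modular and every such x is modular or satisfies
-- Tight x ⊆ Tight m. If m is the lifting of r, then a pair (A , B) is tight
-- for m iff (A ∩ M , B ∩ M) is tight for r. Hence every x with
-- Tight m ⊆ Tight x satisfies x(S) + x(∅) = x(S ∩ M) + x(S ∖ M), is modular in
-- S ∖ M, and so has the tight pairs of the lifting of its restriction to 𝒫 M.
--
-- The case distinctions are constructive: totality of ≤ and existence of
-- suprema imply weak excluded middle and make ≈ stable under ¬¬, and all the
-- propositions to be decided are equalities or inclusions between faces.

module Submission where

open import Defs
open import Algebra.Bundles using (CommutativeRing)
open import Data.Bool.Base using (if_then_else_)
import Data.Bool.Properties as Bool
open import Data.Fin.Subset using (Subset; ∣_∣; ∁)
  renaming (_⊆_ to _⊆ˢ_; _∩_ to _∩ˢ_; _∪_ to _∪ˢ_; ⊥ to ∅ˢ)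
open import Data.Fin.Subset.Properties
  using (⊥⊆; ⊆-antisym; p∩q⊆p; x∈p∩q⁺; ∩-assoc; ∩-comm; ∩-distribˡ-∪;
         ∩-distribʳ-∪; ∩-identityʳ; ∩-idempotentCommutativeMonoid; ∩-inverseʳ;
         ∩-zeroʳ; ∪-identityʳ; p∪∁p≡⊤)
open import Data.Irrelevant using ([_])
open import Data.List.Base
  using (List; []; _∷_; map; foldr; filter; cartesianProduct)
import Data.List.Membership.Propositional as List
open import Data.List.Membership.Propositional.Properties
  using (∈-cartesianProduct⁺; ∈-filter⁺; ∈-filter⁻)
open import Data.List.Relation.Unary.All as All using (All; []; _∷_)
open import Data.List.Relation.Unary.AllPairs using (_∷_)
open import Data.List.Relation.Unary.Any using (here; there)
open import Data.List.Relation.Unary.Unique.Propositional using (Unique)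
open import Data.Nat.Base using (ℕ)
open import Data.Product.Base using (∃; _×_; _,_; proj₁; proj₂)
open import Data.Refinement using (_,_; value; value-injective)
import Data.Refinement.Properties as Refinement
open import Data.Sum.Base as Sum using (_⊎_; inj₁; inj₂)
open import Data.Vec.Properties using (≡-dec)
open import Function.Base using (_∘_)
open import Function.Bundles using (_⇔_; mk⇔)
open import Level using (Lift; lift; lower; _⊔_)
open import Relation.Binary.Bundles using (TotalOrder)
open import Relation.Binary.Definitions using (DecidableEquality)
open import Relation.Binary.PropositionalEquality.Core as ≡
  using (_≡_; cong; cong₂; subst)
open import Relation.Nullary.Decidable using (Dec; yes; no; does; recompute)
open import Relation.Nullary.Negation.Core using (¬_; contradiction)
open import Relation.Unary using (Pred; _∈_; _⊆_; Satisfiable)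

-- Order, equality and finite sums in a complete ordered field.

module OrderedField {c ℓ₁ ℓ₂} (ℝ : CompleteOrderedField c ℓ₁ ℓ₂) where
  open CompleteOrderedField ℝ public

  commutativeRing : CommutativeRing c ℓ₁
  commutativeRing = record { isCommutativeRing = isCommutativeRing }

  totalOrder : TotalOrder c ℓ₁ ℓ₂
  totalOrder = record { isTotalOrder = isTotalOrder }

  open CommutativeRing commutativeRing public
    using ( ring; +-group; +-abelianGroup; refl; sym; trans; reflexive
          ; +-cong; +-congˡ; +-congʳ; +-assoc; +-comm; +-identityˡ; +-identityʳ
          ; -‿cong; -‿inverseˡ; -‿inverseʳ; *-congˡ; *-assoc
          ; *-comm; *-identityˡ; *-identityʳ; distribˡ; distribʳ; zeroˡ; zeroʳ
          ; _-_; +-commutativeSemigroup )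
  open TotalOrder totalOrder public
    using (total; antisym; ≤-respˡ-≈; ≤-respʳ-≈)
    renaming (refl to ≤-refl; trans to ≤-trans; reflexive to ≤-reflexive)
  open import Algebra.Properties.Ring ring public
    using (-‿distribˡ-*; -‿distribʳ-*; [y-z]x≈yx-zx)
  open import Algebra.Properties.Group +-group public
    using () renaming
      ( ε⁻¹≈ε to -0≈0; ⁻¹-involutive to -‿involutive; ∙-cancelʳ to +-cancelʳ
      ; x∙y⁻¹≈ε⇒x≈y to x-y≈0⇒x≈y; x≈y⇒x∙y⁻¹≈ε to x≈y⇒x-y≈0 )
  open import Algebra.Properties.AbelianGroup +-abelianGroup public
    using () renaming (⁻¹-∙-comm to -‿+-comm)
  open import Algebra.Properties.CommutativeSemigroup +-commutativeSemigroup public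
    using () renaming (interchange to +-interchange)

  ≤-resp₂-≈ : ∀ {x x′ y y′} → x ≈ x′ → y ≈ y′ → x ≤ y → x′ ≤ y′
  ≤-resp₂-≈ x≈ y≈ = ≤-respˡ-≈ x≈ ∘ ≤-respʳ-≈ y≈

  +-mono-≤ : ∀ {x y u v} → x ≤ y → u ≤ v → x + u ≤ y + v
  +-mono-≤ {x} {y} {u} {v} x≤y u≤v =
    ≤-trans (+-monoˡ-≤ u x≤y)
            (≤-resp₂-≈ (+-comm u y) (+-comm v y) (+-monoˡ-≤ y u≤v))

  +-cancelˡ-≤ : ∀ {x u v} → x + u ≤ x + v → u ≤ v
  +-cancelˡ-≤ {x} {u} {v} le = ≤-resp₂-≈ (cancel u) (cancel v) (+-mono-≤ (≤-refl { - x}) le)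
    where
    cancel : ∀ z → - x + (x + z) ≈ z
    cancel z = trans (sym (+-assoc _ _ _)) (trans (+-congʳ (-‿inverseˡ x)) (+-identityˡ z))

  x≤y⇒0≤y-x : ∀ {x y} → x ≤ y → 0# ≤ y - x
  x≤y⇒0≤y-x {x} x≤y = ≤-respˡ-≈ (-‿inverseʳ x) (+-monoˡ-≤ (- x) x≤y)

  0≤y-x⇒x≤y : ∀ {x y} → 0# ≤ y - x → x ≤ y
  0≤y-x⇒x≤y {x} {y} le = ≤-resp₂-≈ (+-identityˡ x)
    (trans (+-assoc _ _ _) (trans (+-congˡ (-‿inverseˡ x)) (+-identityʳ y)))
    (+-monoˡ-≤ x le)

  *-monoˡ-≤-nonNeg : ∀ {x y z} → 0# ≤ z → x ≤ y → x * z ≤ y * z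
  *-monoˡ-≤-nonNeg {x} {y} {z} 0≤z x≤y =
    0≤y-x⇒x≤y (≤-respʳ-≈ ([y-z]x≈yx-zx z y x) (*-nonNegative (x≤y⇒0≤y-x x≤y) 0≤z))

  x≤0⇒0≤-x : ∀ {x} → x ≤ 0# → 0# ≤ - x
  x≤0⇒0≤-x x≤0 = ≤-respʳ-≈ (+-identityˡ _) (x≤y⇒0≤y-x x≤0)

  0≤-x⇒x≤0 : ∀ {x} → 0# ≤ - x → x ≤ 0#
  0≤-x⇒x≤0 le = 0≤y-x⇒x≤y (≤-respʳ-≈ (sym (+-identityˡ _)) le)

  -- If `1# ≤ 0#`, then `1#` is the square of the nonnegative `- 1#`.
  0≤1 : 0# ≤ 1#
  0≤1 with total 0# 1#
  ... | inj₁ 0≤1 = 0≤1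
  ... | inj₂ 1≤0 = ≤-respʳ-≈
    (trans (sym (-‿distribˡ-* _ _)) (trans (-‿cong (*-identityˡ _)) (-‿involutive 1#)))
    (*-nonNegative 0≤-1 0≤-1)
    where
    0≤-1 : 0# ≤ - 1#
    0≤-1 = x≤0⇒0≤-x 1≤0

  1≰0 : ¬ 1# ≤ 0#
  1≰0 1≤0 = 0≉1 (antisym 0≤1 1≤0)

  0≰-1 : ¬ 0# ≤ - 1#
  0≰-1 = 1≰0 ∘ 0≤-x⇒x≤0

  +-nonNegative : ∀ {x y} → 0# ≤ x → 0# ≤ y → 0# ≤ x + y
  +-nonNegative 0≤x 0≤y = ≤-respˡ-≈ (+-identityˡ 0#) (+-mono-≤ 0≤x 0≤y)

  nonNeg-+≈0 : ∀ {x y} → 0# ≤ x → 0# ≤ y → x + y ≈ 0# → x ≈ 0# × y ≈ 0#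
  nonNeg-+≈0 {x} {y} 0≤x 0≤y x+y≈0 = x≈0 , y≈0
    where
    x≈0 : x ≈ 0#
    x≈0 = antisym (≤-resp₂-≈ (+-identityʳ x) x+y≈0 (+-mono-≤ ≤-refl 0≤y)) 0≤x
    y≈0 : y ≈ 0#
    y≈0 = trans (sym (+-identityˡ y)) (trans (+-congʳ (sym x≈0)) x+y≈0)

  -- The sign of the supremum of {-1} ∪ {1 ∣ p} decides p.
  weakExcludedMiddle : (p : Set (c ⊔ ℓ₁ ⊔ ℓ₂)) → ¬ p ⊎ ¬ ¬ p
  weakExcludedMiddle p = Sum.map s≤0⇒¬p 0≤s⇒¬¬p (total s 0#)
    where
    P : Pred Carrier (c ⊔ ℓ₁ ⊔ ℓ₂)
    P x = x ≈ - 1# ⊎ (x ≈ 1# × p)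
    bounded : 1# ∈ UpperBound P
    bounded (inj₁ x≈-1) = ≤-respˡ-≈ (sym x≈-1)
      (≤-trans (≤-resp₂-≈ (+-identityˡ _) (-‿inverseʳ 1#) (+-monoˡ-≤ (- 1#) 0≤1)) 0≤1)
    bounded (inj₂ (x≈1 , _)) = ≤-reflexive x≈1
    sup = supremum P (- 1# , inj₁ refl) (1# , bounded)
    s = proj₁ sup
    s≤0⇒¬p : s ≤ 0# → ¬ p
    s≤0⇒¬p s≤0 ⊢p = 1≰0 (≤-trans (proj₁ (proj₂ sup) (inj₂ (refl , ⊢p))) s≤0)
    0≤s⇒¬¬p : 0# ≤ s → ¬ ¬ p
    0≤s⇒¬¬p 0≤s ¬p = 0≰-1 (≤-trans 0≤s (proj₂ (proj₂ sup)
      λ { (inj₁ x≈-1) → ≤-reflexive x≈-1 ; (inj₂ (_ , ⊢p)) → contradiction ⊢p ¬p }))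

  -- The set of all x with ¬ ¬ x ≈ 0 is bounded and closed under doubling, so
  -- its supremum s satisfies s ≤ s - x for each of its members x.
  ¬¬x≈0⇒x≤0 : ∀ {x} → ¬ ¬ x ≈ 0# → x ≤ 0#
  ¬¬x≈0⇒x≤0 {x} ¬¬x≈0 = +-cancelˡ-≤ (≤-respʳ-≈ (sym (+-identityʳ s)) s+x≤s)
    where
    I : Pred Carrier (c ⊔ ℓ₁ ⊔ ℓ₂)
    I y = Lift (c ⊔ ℓ₂) (¬ ¬ y ≈ 0#)
    bounded : 1# ∈ UpperBound I
    bounded {y} (lift ¬¬y≈0) with total y 1#
    ... | inj₁ y≤1 = y≤1
    ... | inj₂ 1≤y = contradiction (λ y≈0 → 1≰0 (≤-respʳ-≈ y≈0 1≤y)) ¬¬y≈0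
    sup = supremum I (0# , lift (λ 0≉0 → 0≉0 refl)) (1# , bounded)
    s = proj₁ sup
    y+x≤s : ∀ {y} → I y → y + x ≤ s
    y+x≤s (lift ¬¬y≈0) = proj₁ (proj₂ sup) (lift λ y+x≉0 →
      ¬¬y≈0 λ y≈0 → ¬¬x≈0 λ x≈0 → y+x≉0 (trans (+-cong y≈0 x≈0) (+-identityˡ 0#)))
    s≤s-x : s ≤ s - x
    s≤s-x = proj₂ (proj₂ sup) λ {y} Iy →
      ≤-respˡ-≈ (trans (+-assoc y x (- x)) (trans (+-congˡ (-‿inverseʳ x)) (+-identityʳ y)))
        (+-monoˡ-≤ (- x) (y+x≤s Iy))
    s+x≤s : s + x ≤ s
    s+x≤s = ≤-respʳ-≈
      (trans (+-assoc s (- x) x) (trans (+-congˡ (-‿inverseˡ x)) (+-identityʳ s)))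
      (+-monoˡ-≤ x s≤s-x)

  -- By antisymmetry two inequalities suffice, and each follows from `¬¬x≈0⇒x≤0` applied to a
  -- difference.
  ≈-stable : ∀ {x y} → ¬ ¬ x ≈ y → x ≈ y
  ≈-stable ¬¬x≈y = antisym (≤⁺ ¬¬x≈y) (≤⁺ (λ y≉x → ¬¬x≈y (y≉x ∘ sym)))
    where
    ≤⁺ : ∀ {x y} → ¬ ¬ x ≈ y → x ≤ y
    ≤⁺ {x} {y} ¬¬x≈y = 0≤y-x⇒x≤y (≤-respʳ-≈
      (trans (sym (-‿+-comm x (- y)))
        (trans (+-congˡ (-‿involutive y)) (+-comm (- x) y)))
      (x≤0⇒0≤-x (¬¬x≈0⇒x≤0 λ x-y≉0 → ¬¬x≈y (x-y≉0 ∘ x≈y⇒x-y≈0))))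

  infix 4 _≈?_
  _≈?_ : ∀ x y → Dec (x ≈ y)
  x ≈? y with weakExcludedMiddle (Lift (c ⊔ ℓ₂) (x ≈ y))
  ... | inj₁ x≉y  = no (x≉y ∘ lift)
  ... | inj₂ ¬x≉y = yes (≈-stable (λ x≉y → ¬x≉y (x≉y ∘ lower)))

  -- The factor is a quotient if `x` is invertible and `0#` otherwise; deciding which is the case
  -- relies on `_≈?_`.
  multiple : ∀ {x y} → (x ≈ 0# → y ≈ 0#) → ∃ λ t → y ≈ t * x
  multiple {x} {y} x≈0⇒y≈0 with x ≈? 0#
  ... | yes x≈0 = 0# , trans (x≈0⇒y≈0 x≈0) (sym (zeroˡ x))
  ... | no x≉0 with x⁻¹ , xx⁻¹≈1 ← inverse x x≉0 =
    y * x⁻¹ , sym (trans (*-assoc y x⁻¹ x)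
      (trans (*-congˡ (trans (*-comm x⁻¹ x) xx⁻¹≈1)) (*-identityʳ y)))

  -- Finite sums.

  ∑ : ∀ {a} {A : Set a} → List A → (A → Carrier) → Carrier
  ∑ xs f = foldr _+_ 0# (map f xs)

  module _ {a} {A : Set a} where

    ∑-cong : ∀ (xs : List A) {f g : A → Carrier} → (∀ x → f x ≈ g x) → ∑ xs f ≈ ∑ xs g
    ∑-cong []       f≈g = refl
    ∑-cong (x ∷ xs) {f} {g} f≈g = +-cong (f≈g x) (∑-cong xs {f} {g} f≈g)

    ∑-zero : ∀ {xs : List A} {f : A → Carrier} → All (λ x → f x ≈ 0#) xs → ∑ xs f ≈ 0#
    ∑-zero []           = refl
    ∑-zero {f = f} (fx≈0 ∷ f≈0) = trans (+-cong fx≈0 (∑-zero {f = f} f≈0)) (+-identityˡ 0#)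

    ∑-+ : ∀ (xs : List A) f g → ∑ xs (λ x → f x + g x) ≈ ∑ xs f + ∑ xs g
    ∑-+ []       f g = sym (+-identityˡ 0#)
    ∑-+ (x ∷ xs) f g = trans (+-congˡ (∑-+ xs f g)) (+-interchange _ _ _ _)

    ∑-* : ∀ (xs : List A) t f → ∑ xs (λ x → t * f x) ≈ t * ∑ xs f
    ∑-* []       t f = sym (zeroʳ t)
    ∑-* (x ∷ xs) t f = trans (+-congˡ (∑-* xs t f)) (sym (distribˡ _ _ _))

    ∑-neg : ∀ (xs : List A) f → ∑ xs (λ x → - f x) ≈ - ∑ xs f
    ∑-neg []       f = sym -0≈0
    ∑-neg (x ∷ xs) f = trans (+-congˡ (∑-neg xs f)) (-‿+-comm _ _)

    ∑-nonNeg : ∀ (xs : List A) {f : A → Carrier} → (∀ x → 0# ≤ f x) → 0# ≤ ∑ xs f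
    ∑-nonNeg []       0≤f = ≤-refl
    ∑-nonNeg (x ∷ xs) {f} 0≤f = +-nonNegative (0≤f x) (∑-nonNeg xs {f} 0≤f)

    -- This lets one functional, a sum of valid inequalities, detect equality in each of them.
    ∑-nonNeg-≈0 : ∀ (xs : List A) {f : A → Carrier} → (∀ x → 0# ≤ f x) → ∑ xs f ≈ 0# →
                  All (λ x → f x ≈ 0#) xs
    ∑-nonNeg-≈0 []       0≤f ∑≈0 = []
    ∑-nonNeg-≈0 (x ∷ xs) {f} 0≤f ∑≈0
      with fx≈0 , ∑xs≈0 ← nonNeg-+≈0 (0≤f x) (∑-nonNeg xs {f} 0≤f) ∑≈0
      = fx≈0 ∷ ∑-nonNeg-≈0 xs {f} 0≤f ∑xs≈0

    indicator : DecidableEquality A → A → A → Carrier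
    indicator _≟_ y x = if does (y ≟ x) then 1# else 0#

    *-indicator-≡ : ∀ (_≟_ : DecidableEquality A) (f : A → Carrier) x → f x * indicator _≟_ x x ≈ f x
    *-indicator-≡ _≟_ f x with x ≟ x
    ... | yes _  = *-identityʳ (f x)
    ... | no x≢x = contradiction ≡.refl x≢x

    *-indicator-≢ : ∀ (_≟_ : DecidableEquality A) (f : A → Carrier) {x y} → ¬ y ≡ x →
                    f x * indicator _≟_ y x ≈ 0#
    *-indicator-≢ _≟_ f {x} {y} y≢x with y ≟ x
    ... | yes y≡x = contradiction y≡x y≢x
    ... | no _    = zeroʳ (f x)

    -- All summands away from `y` vanish, and uniqueness makes `y` occur only once.
    ∑-indicator : ∀ (_≟_ : DecidableEquality A) {xs} → Unique xs → ∀ {y} → y List.∈ xs →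
                  ∀ (f : A → Carrier) → ∑ xs (λ x → f x * indicator _≟_ y x) ≈ f y
    ∑-indicator _≟_ {x ∷ _} (x∉xs ∷ _) (here ≡.refl) f = trans
      (+-cong (*-indicator-≡ _≟_ f x)
        (∑-zero {f = λ z → f z * indicator _≟_ x z} (All.map (*-indicator-≢ _≟_ f) x∉xs)))
      (+-identityʳ (f x))
    ∑-indicator _≟_ (x∉xs ∷ uniq) (there y∈xs) f = trans
      (+-cong (*-indicator-≢ _≟_ f (All.lookup x∉xs y∈xs ∘ ≡.sym)) (∑-indicator _≟_ uniq y∈xs f))
      (+-identityˡ _)

    -- The largest of the factors supplied by `multiple` works for the whole list, because `f` is
    -- nonnegative and so enlarging `t` preserves each inequality.
    dominatingMultiple : ∀ (xs : List A) {f g : A → Carrier} → (∀ x → 0# ≤ f x) →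
                         (∀ x → f x ≈ 0# → g x ≈ 0#) →
                         ∃ λ t → All (λ x → g x ≤ t * f x) xs
    dominatingMultiple [] 0≤f f≈0⇒g≈0 = 0# , []
    dominatingMultiple (x ∷ xs) {f} {g} 0≤f f≈0⇒g≈0
      with t₁ , g≤t₁f ← dominatingMultiple xs {f} {g} 0≤f f≈0⇒g≈0
         | t₂ , gx≈t₂fx ← multiple (f≈0⇒g≈0 x)
      with gx≤t₂fx ← ≤-reflexive gx≈t₂fx
         | total t₁ t₂
    ... | inj₁ t₁≤t₂ =
      t₂ , gx≤t₂fx ∷ All.map (λ {y} le → ≤-trans le (*-monoˡ-≤-nonNeg (0≤f y) t₁≤t₂)) g≤t₁f
    ... | inj₂ t₂≤t₁ =
      t₁ , ≤-trans gx≤t₂fx (*-monoˡ-≤-nonNeg (0≤f x) t₂≤t₁) ∷ g≤t₁f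

  ∑-swap : ∀ {a b} {A : Set a} {B : Set b} (xs : List A) (ys : List B) (f : A → B → Carrier) →
           ∑ xs (λ x → ∑ ys (f x)) ≈ ∑ ys (λ y → ∑ xs (λ x → f x y))
  ∑-swap []       ys f = sym (∑-zero {xs = ys} {f = λ _ → 0#} (All.universal (λ _ → refl) ys))
  ∑-swap (x ∷ xs) ys f = trans (+-congˡ (∑-swap xs ys f)) (sym (∑-+ ys (f x) _))

-- Traces of subsets and the splitting of a set by `Y` and its complement.

module _ {n : ℕ} where

  _≟_ : {X : Subset n} → DecidableEquality (𝒫 X)
  _≟_ = Refinement._≟_ (≡-dec Bool._≟_)

  ∅ : {X : Subset n} → 𝒫 X
  ∅ = ∅ˢ , [ ⊥⊆ ]

  p⊆q⇒p∩q≡p : {p q : Subset n} → p ⊆ˢ q → p ∩ˢ q ≡ p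
  p⊆q⇒p∩q≡p {p} {q} p⊆q = ⊆-antisym (p∩q⊆p p q) (λ x∈p → x∈p∩q⁺ (x∈p , p⊆q x∈p))

  value∩ : {X : Subset n} (A : 𝒫 X) → value A ∩ˢ X ≡ value A
  -- The bound `A⊆X` is irrelevant, so the equation is recovered from its decidability.
  value∩ (A , [ A⊆X ]) = recompute (≡-dec Bool._≟_ _ _) (p⊆q⇒p∩q≡p A⊆X)

  ∪-∅ : {X : Subset n} (A : 𝒫 X) → A ∪ ∅ ≡ A
  ∪-∅ A = value-injective (∪-identityʳ (value A))

  ∩-∅ : {X : Subset n} (A : 𝒫 X) → A ∩ ∅ ≡ ∅
  ∩-∅ A = value-injective (∩-zeroʳ (value A))

  trace-∪ : {X : Subset n} (Y : Subset n) (A B : 𝒫 X) →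
            trace Y (A ∪ B) ≡ trace Y A ∪ trace Y B
  trace-∪ Y A B = value-injective (∩-distribʳ-∪ Y (value A) (value B))

  trace-∩ : {X : Subset n} (Y : Subset n) (A B : 𝒫 X) →
            trace Y (A ∩ B) ≡ trace Y A ∩ trace Y B
  trace-∩ Y A B = value-injective (∙-distrʳ-∙ Y (value A) (value B))
    where
    open import Algebra.Properties.IdempotentCommutativeMonoid
      (∩-idempotentCommutativeMonoid n) using () renaming (∙-distrʳ-∙ to ∙-distrʳ-∙)

  module _ {N : Subset n} where

    -- The double trace makes `x (part Y S)` by definition the value of the restriction
    -- `x ∘ trace N` at `trace Y S`. The outer trace only restores the type `𝒫 N`, since `S ∩ Y`
    -- already lies in `N`.
    part : Subset n → 𝒫 N → 𝒫 N
    part Y S = trace N (trace Y S)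

    value-part : ∀ Y S → value (part Y S) ≡ value S ∩ˢ Y
    value-part Y S = ≡.trans (∩-assoc (value S) Y N)
      (≡.trans (cong (value S ∩ˢ_) (∩-comm Y N))
        (≡.trans (≡.sym (∩-assoc (value S) N Y)) (cong (_∩ˢ Y) (value∩ S))))

    part-∪-∁ : ∀ Y S → part Y S ∪ part (∁ Y) S ≡ S
    part-∪-∁ Y S = value-injective (≡.trans
      (cong₂ _∪ˢ_ (value-part Y S) (value-part (∁ Y) S))
      (≡.trans (≡.sym (∩-distribˡ-∪ (value S) Y (∁ Y)))
        (≡.trans (cong (value S ∩ˢ_) (p∪∁p≡⊤ Y)) (∩-identityʳ (value S)))))

    trace-part-∁ : ∀ Y S → trace Y (part (∁ Y) S) ≡ ∅
    trace-part-∁ Y S = value-injective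
      (≡.trans (cong (_∩ˢ Y) (value-part (∁ Y) S))
        (≡.trans (∩-assoc (value S) (∁ Y) Y)
          (≡.trans (cong (value S ∩ˢ_) (≡.trans (∩-comm (∁ Y) Y) (∩-inverseʳ Y)))
            (∩-zeroʳ (value S)))))

    part-∩-∁ : ∀ Y S → part Y S ∩ part (∁ Y) S ≡ ∅
    part-∩-∁ Y S = value-injective
      (≡.trans (cong₂ _∩ˢ_ (value-part Y S) (≡.refl {x = value (part (∁ Y) S)}))
        (≡.trans (∩-assoc (value S) Y (value (part (∁ Y) S)))
          (≡.trans (cong (value S ∩ˢ_)
              (≡.trans (∩-comm Y (value (part (∁ Y) S))) (cong value (trace-part-∁ Y S))))
            (∩-zeroʳ (value S)))))

  trace-trace : {M N : Subset n} → M ⊆ˢ N → (A : 𝒫 M) → trace M (trace N A) ≡ A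
  trace-trace {M} {N} M⊆N A = value-injective
    (≡.trans (∩-assoc (value A) N M)
      (≡.trans (cong (value A ∩ˢ_) (≡.trans (∩-comm N M) (p⊆q⇒p∩q≡p M⊆N))) (value∩ A)))

module SupermodularCone {c ℓ₁ ℓ₂} (ℝ : CompleteOrderedField c ℓ₁ ℓ₂) {n : ℕ} where
  open OrderedField ℝ
  open SetFunctions ℝ
  open Face

  -- Bilinearity of the scalar product and evaluation at a subset.

  module _ {X : Subset n} where

    ⟨⟩-+ʳ : ∀ (x u w : ℝ^𝒫 X) → ⟨ x , (λ C → u C + w C) ⟩ ≈ ⟨ x , u ⟩ + ⟨ x , w ⟩
    ⟨⟩-+ʳ x u w = trans
      (∑-cong (subsets X) (λ C → distribˡ (x C) (u C) (w C)))
      (∑-+ (subsets X) (λ C → x C * u C) (λ C → x C * w C))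

    ⟨⟩-negʳ : ∀ (x u : ℝ^𝒫 X) → ⟨ x , (λ C → - u C) ⟩ ≈ - ⟨ x , u ⟩
    ⟨⟩-negʳ x u =
      trans (∑-cong (subsets X) (λ C → sym (-‿distribʳ-* (x C) (u C))))
            (∑-neg (subsets X) (λ C → x C * u C))

    ⟨⟩-∑ʳ : ∀ {a} {A : Set a} (x : ℝ^𝒫 X) (ys : List A) (f : A → ℝ^𝒫 X) →
            ⟨ x , (λ C → ∑ ys (λ y → f y C)) ⟩ ≈ ∑ ys (λ y → ⟨ x , f y ⟩)
    ⟨⟩-∑ʳ x ys f = trans
      (∑-cong (subsets X) (λ C → sym (∑-* ys (x C) (λ y → f y C))))
      (∑-swap (subsets X) ys (λ C y → x C * f y C))

    ⟨⟩-+ˡ : ∀ (x y u : ℝ^𝒫 X) → ⟨ (λ C → x C + y C) , u ⟩ ≈ ⟨ x , u ⟩ + ⟨ y , u ⟩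
    ⟨⟩-+ˡ x y u = trans
      (∑-cong (subsets X) (λ C → distribʳ (u C) (x C) (y C)))
      (∑-+ (subsets X) (λ C → x C * u C) (λ C → y C * u C))

    ⟨⟩-negˡ : ∀ (x u : ℝ^𝒫 X) → ⟨ (λ C → - x C) , u ⟩ ≈ - ⟨ x , u ⟩
    ⟨⟩-negˡ x u =
      trans (∑-cong (subsets X) (λ C → sym (-‿distribˡ-* (x C) (u C))))
            (∑-neg (subsets X) (λ C → x C * u C))

    ⟨⟩-*ˡ : ∀ t (x u : ℝ^𝒫 X) → ⟨ (λ C → t * x C) , u ⟩ ≈ t * ⟨ x , u ⟩
    ⟨⟩-*ˡ t x u = trans (∑-cong (subsets X) (λ C → *-assoc t (x C) (u C)))
                        (∑-* (subsets X) t (λ C → x C * u C))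

    ⟨tx-y,u⟩ : ∀ t (x y u : ℝ^𝒫 X) →
               ⟨ (λ C → t * x C - y C) , u ⟩ ≈ t * ⟨ x , u ⟩ - ⟨ y , u ⟩
    ⟨tx-y,u⟩ t x y u =
      trans (⟨⟩-+ˡ (λ C → t * x C) (λ C → - y C) u) (+-cong (⟨⟩-*ˡ t x u) (⟨⟩-negˡ y u))

    0ᶠ : ℝ^𝒫 X
    0ᶠ _ = 0#

    ⟨0,u⟩≈0 : ∀ u → ⟨ 0ᶠ , u ⟩ ≈ 0#
    ⟨0,u⟩≈0 u = ∑-zero (All.universal (λ C → zeroˡ (u C)) (subsets X))

    δ : 𝒫 X → ℝ^𝒫 X
    δ = indicator _≟_

    ⟨x,δA⟩≈xA : ∀ (x : ℝ^𝒫 X) A → ⟨ x , δ A ⟩ ≈ x A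
    ⟨x,δA⟩≈xA x A = ∑-indicator _≟_ (subsets-unique X) (subsets-complete X A) x

    -- The supermodular inequalities as linear functionals.

    pairs : List (𝒫 X × 𝒫 X)
    pairs = cartesianProduct (subsets X) (subsets X)

    pairs-complete : ∀ p → p List.∈ pairs
    pairs-complete (A , B) = ∈-cartesianProduct⁺ (subsets-complete X A) (subsets-complete X B)

    -- Pairing with this vector gives the slack of the supermodular inequality for `A` and `B`:
    -- nonnegative on the cone, zero exactly at tight pairs.
    w : 𝒫 X × 𝒫 X → ℝ^𝒫 X
    w (A , B) C = (δ (A ∪ B) C + δ (A ∩ B) C) - (δ A C + δ B C)

    ⟨x,w⟩ : ∀ (x : ℝ^𝒫 X) A B →
            ⟨ x , w (A , B) ⟩ ≈ (x (A ∪ B) + x (A ∩ B)) - (x A + x B)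
    ⟨x,w⟩ x A B = trans (⟨⟩-+ʳ x _ _)
      (+-cong (sum (A ∪ B) (A ∩ B)) (trans (⟨⟩-negʳ x _) (-‿cong (sum A B))))
      where
      sum : ∀ A B → ⟨ x , (λ C → δ A C + δ B C) ⟩ ≈ x A + x B
      sum A B = trans (⟨⟩-+ʳ x _ _) (+-cong (⟨x,δA⟩≈xA x A) (⟨x,δA⟩≈xA x B))

    𝒦⇒0≤⟨x,w⟩ : ∀ {x} → x ∈ 𝒦 X → ∀ p → 0# ≤ ⟨ x , w p ⟩
    𝒦⇒0≤⟨x,w⟩ x∈𝒦 (A , B) = ≤-respʳ-≈ (sym (⟨x,w⟩ _ A B)) (x≤y⇒0≤y-x (x∈𝒦 A B))

    0≤⟨x,w⟩⇒𝒦 : ∀ {x} → (∀ p → 0# ≤ ⟨ x , w p ⟩) → x ∈ 𝒦 X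
    0≤⟨x,w⟩⇒𝒦 0≤ A B = 0≤y-x⇒x≤y (≤-respʳ-≈ (⟨x,w⟩ _ A B) (0≤ (A , B)))

    Tight : ℝ^𝒫 X → Pred (𝒫 X × 𝒫 X) ℓ₁
    Tight x (A , B) = x A + x B ≈ x (A ∪ B) + x (A ∩ B)

    Modular : Pred (ℝ^𝒫 X) ℓ₁
    Modular x = ∀ p → p ∈ Tight x

    Tight⇒⟨x,w⟩≈0 : ∀ {x} p → p ∈ Tight x → ⟨ x , w p ⟩ ≈ 0#
    Tight⇒⟨x,w⟩≈0 {x} (A , B) tight = trans (⟨x,w⟩ x A B) (x≈y⇒x-y≈0 (sym tight))

    ⟨x,w⟩≈0⇒Tight : ∀ {x} p → ⟨ x , w p ⟩ ≈ 0# → p ∈ Tight x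
    ⟨x,w⟩≈0⇒Tight {x} (A , B) ≈0 = sym (x-y≈0⇒x≈y _ _ (trans (sym (⟨x,w⟩ x A B)) ≈0))

    0-modular : Modular 0ᶠ
    0-modular _ = refl

    0∈𝒦 : 0ᶠ ∈ 𝒦 X
    0∈𝒦 _ _ = ≤-refl

    -- Smallest faces of the supermodular cone.

    tightPairs : ℝ^𝒫 X → List (𝒫 X × 𝒫 X)
    tightPairs m = filter (λ (A , B) → m A + m B ≈? m (A ∪ B) + m (A ∩ B)) pairs

    ⟨x,Σw⟩ : ∀ x m → ⟨ x , (λ C → ∑ (tightPairs m) (λ p → w p C)) ⟩ ≈
                     ∑ (tightPairs m) (λ p → ⟨ x , w p ⟩)
    ⟨x,Σw⟩ x m = ⟨⟩-∑ʳ x (tightPairs m) w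

    face : ℝ^𝒫 X → Face (𝒦 X)
    face m = record
      { v     = λ C → ∑ (tightPairs m) (λ p → w p C)
      ; k     = 0#
      ; valid = λ {x} x∈𝒦 → ≤-respʳ-≈ (sym (⟨x,Σw⟩ x m))
                              (∑-nonNeg (tightPairs m) (𝒦⇒0≤⟨x,w⟩ x∈𝒦))
      }

    ∈face⁺ : ∀ {m x} → x ∈ 𝒦 X → Tight m ⊆ Tight x → x ∈ ⟦ face m ⟧
    ∈face⁺ {m} {x} x∈𝒦 m⊆x = x∈𝒦 , sym (trans (⟨x,Σw⟩ x m) (∑-zero (All.tabulate
      λ {p} p∈ → Tight⇒⟨x,w⟩≈0 p (m⊆x (proj₂ (∈-filter⁻ _ {xs = pairs} p∈))))))

    ∈face⁻ : ∀ {m x} → x ∈ ⟦ face m ⟧ → Tight m ⊆ Tight x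
    ∈face⁻ {m} {x} (x∈𝒦 , 0≈) {p} tight = ⟨x,w⟩≈0⇒Tight p (All.lookup
      (∑-nonNeg-≈0 (tightPairs m) (𝒦⇒0≤⟨x,w⟩ x∈𝒦) (trans (sym (⟨x,Σw⟩ x m)) (sym 0≈)))
      (∈-filter⁺ _ (pairs-complete p) tight))

    -- Validity at `0ᶠ` gives `k ≤ 0`. The cone also contains `m + m`, where validity reads
    -- `k ≤ k + k`.
    k≈0 : ∀ (G : Face (𝒦 X)) {m} → m ∈ ⟦ G ⟧ → k G ≈ 0#
    k≈0 G {m} (m∈𝒦 , k≈) = antisym
      (≤-respʳ-≈ (⟨0,u⟩≈0 (v G)) (valid G 0∈𝒦))
      (+-cancelˡ-≤ (≤-resp₂-≈ (sym (+-identityʳ _))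
        (trans (⟨⟩-+ˡ m m (v G)) (+-cong (sym k≈) (sym k≈))) (valid G m+m∈𝒦)))
      where
      m+m∈𝒦 : (λ C → m C + m C) ∈ 𝒦 X
      m+m∈𝒦 A B = ≤-resp₂-≈ (+-interchange _ _ _ _) (+-interchange _ _ _ _)
                            (+-mono-≤ (m∈𝒦 A B) (m∈𝒦 A B))

    -- Some multiple t m dominates x in the order of 𝒦 X, and t m - x ∈ 𝒦 X
    -- forces ⟨ x , v ⟩ ≤ 0 for every v with ⟨ m , v ⟩ = 0 exposing a face.
    face-smallest : ∀ {m} → m ∈ 𝒦 X → IsSmallestFaceContaining m (face m)
    face-smallest {m} m∈𝒦 = ∈face⁺ m∈𝒦 (λ tight → tight) , smallest
      where
      smallest : ∀ (G : Face (𝒦 X)) → m ∈ ⟦ G ⟧ → ⟦ face m ⟧ ⊆ ⟦ G ⟧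
      smallest G m∈G {x} x∈F@(x∈𝒦 , _)
        with t , x≤tm ← dominatingMultiple pairs (𝒦⇒0≤⟨x,w⟩ m∈𝒦)
               (λ p ≈0 → Tight⇒⟨x,w⟩≈0 p (∈face⁻ x∈F (⟨x,w⟩≈0⇒Tight p ≈0)))
        = x∈𝒦 , antisym (valid G x∈𝒦) (≤-respʳ-≈ (sym (k≈0 G m∈G)) (0≤-x⇒x≤0
            (≤-resp₂-≈ (k≈0 G m∈G) ⟨tm-x,v⟩ (valid G tm-x∈𝒦))))
        where
        tm-x∈𝒦 : (λ C → t * m C - x C) ∈ 𝒦 X
        tm-x∈𝒦 = 0≤⟨x,w⟩⇒𝒦 λ p → ≤-respʳ-≈ (sym (⟨tx-y,u⟩ t m x (w p)))
                   (x≤y⇒0≤y-x (All.lookup x≤tm (pairs-complete p)))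
        ⟨tm-x,v⟩ : ⟨ (λ C → t * m C - x C) , v G ⟩ ≈ - ⟨ x , v G ⟩
        ⟨tm-x,v⟩ = trans (⟨tx-y,u⟩ t m x (v G)) (trans (+-congʳ (trans
          (*-congˡ (trans (sym (proj₂ m∈G)) (k≈0 G m∈G))) (zeroʳ t))) (+-identityˡ _))

    -- Since `k` vanishes, `0ᶠ` lies in every non-empty face, and every pair is tight for `0ᶠ`, so
    -- its smallest face consists of the modular functions.
    modularFace-least : ∀ (G : Face (𝒦 X)) → Satisfiable ⟦ G ⟧ → ⟦ face 0ᶠ ⟧ ⊆ ⟦ G ⟧
    modularFace-least G (m , m∈G) = proj₂ (face-smallest 0∈𝒦) G
      (0∈𝒦 , trans (k≈0 G m∈G) (sym (⟨0,u⟩≈0 (v G))))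

    -- Extremality expressed by tight pairs.

    OnExtremeRay : Pred (ℝ^𝒫 X) (c ⊔ ℓ₁ ⊔ ℓ₂)
    OnExtremeRay m = ¬ Modular m ×
      (∀ {x} → x ∈ 𝒦 X → Tight m ⊆ Tight x → Modular x ⊎ Tight x ⊆ Tight m)

    -- The given least face `E` must be the space of modular functions, and the dichotomy for `x` is
    -- the atom property applied to `face x`.
    Extreme⇒OnExtremeRay : ∀ {m} → m ∈ Extreme X → OnExtremeRay m
    Extreme⇒OnExtremeRay {m}
      (m∈𝒦 , (F , _) , (m∈F , F-least) , (E , E≠∅) , E-min , F≉E , atom) =
      (λ modular → F≉E (F⊆E modular , λ {x} → E⊆F {x})) , dichotomy
      where
      ∈Fx : ∀ {x} → x ∈ 𝒦 X → x ∈ ⟦ face x ⟧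
      ∈Fx x∈𝒦 = proj₁ (face-smallest x∈𝒦)
      E⊆modular : ⟦ E ⟧ ⊆ ⟦ face 0ᶠ ⟧
      E⊆modular {x} = E-min (face 0ᶠ , 0ᶠ , ∈Fx 0∈𝒦) {x}
      F⊆E : Modular m → ⟦ F ⟧ ⊆ ⟦ E ⟧
      F⊆E modular {x} x∈F = modularFace-least E E≠∅ {x}
        (F-least (face 0ᶠ) (∈face⁺ m∈𝒦 (λ {p} _ → modular p)) {x} x∈F)
      E⊆F : ⟦ E ⟧ ⊆ ⟦ F ⟧
      E⊆F {x} x∈E = modularFace-least F (m , m∈F) {x} (E⊆modular {x} x∈E)
      dichotomy : ∀ {x} → x ∈ 𝒦 X → Tight m ⊆ Tight x → Modular x ⊎ Tight x ⊆ Tight m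
      dichotomy {x} x∈𝒦 m⊆x = Sum.map
        (λ (Fx⊆E , _) p → ∈face⁻ {0ᶠ} {x} (E⊆modular {x} (Fx⊆E {x} (∈Fx x∈𝒦))) {p} (0-modular p))
        (λ (_ , F⊆Fx) {p} → ∈face⁻ {x} {m} (F⊆Fx {m} m∈F) {p})
        (atom (face x , x , ∈Fx x∈𝒦) (λ {y} → proj₂ (face-smallest x∈𝒦) F x∈F {y}))
        where
        x∈F : x ∈ ⟦ F ⟧
        x∈F = proj₂ (face-smallest m∈𝒦) F m∈F {x} (∈face⁺ x∈𝒦 m⊆x)

    -- The dichotomy speaks of single functions, whereas an atom is tested against an arbitrary face
    -- `G`. Weak excluded middle therefore first decides whether `G` contains only modular
    -- functions, up to a double negation.
    OnExtremeRay⇒Extreme : ∀ {m} → m ∈ 𝒦 X → OnExtremeRay m → m ∈ Extreme X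
    OnExtremeRay⇒Extreme {m} m∈𝒦 (¬modular , dichotomy) =
      m∈𝒦 , (face m , m , m∈F) , face-smallest m∈𝒦 ,
      (face 0ᶠ , 0ᶠ , proj₁ (face-smallest 0∈𝒦)) ,
      (λ (G , G≠∅) {x} → modularFace-least G G≠∅ {x}) ,
      (λ (F⊆E , _) → ¬modular λ p → ∈face⁻ {0ᶠ} {m} (F⊆E {m} m∈F) {p} (0-modular p)) ,
      atom
      where
      m∈F = proj₁ (face-smallest m∈𝒦)
      atom : ∀ (G : NonEmptyFace (𝒦 X)) → ⟦ proj₁ G ⟧ ⊆ ⟦ face m ⟧ →
             (⟦ proj₁ G ⟧ ⊆ ⟦ face 0ᶠ ⟧ × ⟦ face 0ᶠ ⟧ ⊆ ⟦ proj₁ G ⟧) ⊎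
             (⟦ proj₁ G ⟧ ⊆ ⟦ face m ⟧ × ⟦ face m ⟧ ⊆ ⟦ proj₁ G ⟧)
      atom (G , G≠∅) G⊆F = Sum.map G⊆modular G⊈modular
        (Sum.swap (weakExcludedMiddle (⟦ G ⟧ ⊆ ⟦ face 0ᶠ ⟧)))
        where
        G⊆modular : ¬ ¬ (⟦ G ⟧ ⊆ ⟦ face 0ᶠ ⟧) →
                    ⟦ G ⟧ ⊆ ⟦ face 0ᶠ ⟧ × ⟦ face 0ᶠ ⟧ ⊆ ⟦ G ⟧
        G⊆modular ¬G⊈E =
          -- For a member of the cone, lying in a face is a single equation, so the double negation
          -- can be removed pointwise.
          (λ {x} x∈G → proj₁ x∈G ,
            ≈-stable λ 0≉ → ¬G⊈E λ G⊆E → 0≉ (proj₂ (G⊆E {x} x∈G))) ,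
          (λ {x} → modularFace-least G G≠∅ {x})
        -- Here `Tight y ⊆ Tight m ⊆ Tight x`, so `x` lies in the smallest face of `y`, which `G`
        -- contains.
        F⊆G : ∀ {y} → y ∈ ⟦ G ⟧ → Tight y ⊆ Tight m → ⟦ face m ⟧ ⊆ ⟦ G ⟧
        F⊆G {y} y∈G y⊆m {x} x∈F = proj₂ (face-smallest (proj₁ y∈G)) G y∈G {x}
          (∈face⁺ {y} {x} (proj₁ x∈F) (λ {p} → ∈face⁻ {m} {x} x∈F {p} ∘ y⊆m {p}))
        G⊈modular : ¬ (⟦ G ⟧ ⊆ ⟦ face 0ᶠ ⟧) →
                    ⟦ G ⟧ ⊆ ⟦ face m ⟧ × ⟦ face m ⟧ ⊆ ⟦ G ⟧
        -- If some `x` in `face m` were outside `G`, then `F⊆G` would rule out the second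
        -- alternative of the dichotomy for every `y` in `G`. All of `G` would be modular, contrary
        -- to `G⊈E`.
        G⊈modular G⊈E = (λ {x} → G⊆F {x}) , λ {x} x∈F → proj₁ x∈F ,
          ≈-stable λ k≉ → G⊈E λ {y} y∈G → modular {x} {y} k≉ x∈F y∈G
            (dichotomy (proj₁ y∈G) (λ {p} → ∈face⁻ {m} {y} (G⊆F {y} y∈G) {p}))
          where
          modular : ∀ {x y} → ¬ k G ≈ ⟨ x , v G ⟩ → x ∈ ⟦ face m ⟧ → y ∈ ⟦ G ⟧ →
                    Modular y ⊎ Tight y ⊆ Tight m → y ∈ ⟦ face 0ᶠ ⟧
          modular k≉ x∈F y∈G (inj₁ y-modular) =
            ∈face⁺ {0ᶠ} (proj₁ y∈G) (λ {p} _ → y-modular p)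
          modular {x} {y} k≉ x∈F y∈G (inj₂ y⊆m) =
            contradiction (proj₂ (F⊆G {y} y∈G y⊆m {x} x∈F)) k≉

  -- Supermodularity and tight pairs under traces.

  module _ {X Y : Subset n} where

    -- y ∘ trace Y is the lifting of y if Y ⊆ X, and its restriction if X ⊆ Y.
    trace-𝒦 : ∀ {y} → y ∈ 𝒦 Y → (y ∘ trace {X = X} Y) ∈ 𝒦 X
    trace-𝒦 {y} y∈𝒦 A B = ≤-respʳ-≈
      (reflexive (cong₂ _+_ (cong y (≡.sym (trace-∪ Y A B))) (cong y (≡.sym (trace-∩ Y A B)))))
      (y∈𝒦 (trace Y A) (trace Y B))

    trace-Tight⁺ : ∀ {y} (A B : 𝒫 X) → (trace Y A , trace Y B) ∈ Tight y →
                   (A , B) ∈ Tight (y ∘ trace Y)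
    trace-Tight⁺ {y} A B tight = trans tight
      (reflexive (cong₂ _+_ (cong y (≡.sym (trace-∪ Y A B))) (cong y (≡.sym (trace-∩ Y A B)))))

    trace-Tight⁻ : ∀ {y} (A B : 𝒫 X) → (A , B) ∈ Tight (y ∘ trace Y) →
                   (trace Y A , trace Y B) ∈ Tight y
    trace-Tight⁻ {y} A B tight = trans tight
      (reflexive (cong₂ _+_ (cong y (trace-∪ Y A B)) (cong y (trace-∩ Y A B))))

  module _ {X : Subset n} where

    Tight-resp-≈ : ∀ {x y : ℝ^𝒫 X} → (∀ A → x A ≈ y A) → Tight x ⊆ Tight y
    Tight-resp-≈ x≈y {A , B} tight = trans (+-cong (sym (x≈y A)) (sym (x≈y B)))
      (trans tight (+-cong (x≈y (A ∪ B)) (x≈y (A ∩ B))))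

    -- The preimages of such degenerate pairs under `trace M` are tight for a lifting from `M`; they
    -- are what forces `x` to split along `M`.
    Tight-∅ʳ : ∀ (x : ℝ^𝒫 X) A → (A , ∅) ∈ Tight x
    Tight-∅ʳ x A = reflexive (cong₂ _+_ (cong x (≡.sym (∪-∅ A))) (cong x (≡.sym (∩-∅ A))))

  -- Tight pairs of a lifting and transfer of extremality.

  module Lifting {N M : Subset n} (M⊆N : M ⊆ˢ N) (r : ℝ^𝒫 M) (m : ℝ^𝒫 N)
                 (lifting : m IsLiftingOf r) where

    Tight-m⁺ : ∀ A B → (trace M A , trace M B) ∈ Tight r → (A , B) ∈ Tight m
    Tight-m⁺ A B tight = Tight-resp-≈ {x = r ∘ trace M} {y = m} (sym ∘ lifting) {A , B}
      (trace-Tight⁺ {y = r} A B tight)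

    Tight-m⁻ : ∀ A B → (A , B) ∈ Tight m → (trace M A , trace M B) ∈ Tight r
    Tight-m⁻ A B tight = trace-Tight⁻ {y = r} A B
      (Tight-resp-≈ {x = m} {y = r ∘ trace M} lifting {A , B} tight)

    traces≡ : ∀ A B → (trace M (trace N A) , trace M (trace N B)) ≡ (A , B)
    traces≡ A B = cong₂ _,_ (trace-trace M⊆N A) (trace-trace M⊆N B)

    Tight-r⁺ : ∀ A B → (trace N A , trace N B) ∈ Tight m → (A , B) ∈ Tight r
    Tight-r⁺ A B = subst (Tight r) (traces≡ A B) ∘ Tight-m⁻ (trace N A) (trace N B)

    Tight-r⁻ : ∀ A B → (A , B) ∈ Tight r → (trace N A , trace N B) ∈ Tight m
    Tight-r⁻ A B = Tight-m⁺ (trace N A) (trace N B) ∘ subst (Tight r) (≡.sym (traces≡ A B))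

    module _ {x : ℝ^𝒫 N} (m⊆x : Tight m ⊆ Tight x) where

      restriction : ℝ^𝒫 M
      restriction = x ∘ trace N

      Tight-r⊆restriction : Tight r ⊆ Tight restriction
      Tight-r⊆restriction {A , B} = trace-Tight⁺ {y = x} A B ∘ m⊆x ∘ Tight-r⁻ A B

      -- Both sets have empty trace on `M`, so `m` is tight at this pair.
      parts-modular : ∀ A B → (part (∁ M) A , part (∁ M) B) ∈ Tight x
      parts-modular A B = m⊆x (Tight-m⁺ _ _
        (≡.subst₂ (λ A′ B′ → (A′ , B′) ∈ Tight r)
          (≡.sym (trace-part-∁ M A)) (≡.sym (trace-part-∁ M B)) (Tight-∅ʳ r ∅)))

      -- The two parts have union `S` and empty intersection, and they form a tight pair of `m`
      -- because the second has empty trace on `M`.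
      decompose : ∀ S → x (part M S) + x (part (∁ M) S) ≈ x S + x ∅
      decompose S = trans
        (m⊆x {part M S , part (∁ M) S} (Tight-m⁺ _ _
          (subst (λ A → (trace M (part M S) , A) ∈ Tight r)
            (≡.sym (trace-part-∁ M S)) (Tight-∅ʳ r (trace M (part M S))))))
        (reflexive (cong₂ _+_ (cong x (part-∪-∁ M S)) (cong x (part-∩-∁ M S))))

      decompose₂ : ∀ S T → (x (part M S) + x (part M T)) +
                           (x (part (∁ M) S) + x (part (∁ M) T)) ≈
                           (x S + x T) + (x ∅ + x ∅)
      decompose₂ S T = trans (+-interchange _ _ _ _)
        (trans (+-cong (decompose S) (decompose T)) (+-interchange _ _ _ _))

      -- Follows from `parts-modular`: a part is a trace of a trace, so union and intersection are
      -- moved inside by using `trace-Tight⁺` twice.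
      parts-tight : ∀ A B → x (part (∁ M) A) + x (part (∁ M) B) ≈
                            x (part (∁ M) (A ∪ B)) + x (part (∁ M) (A ∩ B))
      parts-tight A B = trace-Tight⁺ {y = restriction′} A B
        (trace-Tight⁺ {y = x} (trace (∁ M) A) (trace (∁ M) B) (parts-modular A B))
        where
        restriction′ : ℝ^𝒫 (∁ M)
        restriction′ = x ∘ trace N

      -- Up to the constant `x ∅ + x ∅`, the equation for `x` at `(A , B)` is the sum of the
      -- equations for the parts inside and outside `M`, and the latter always holds.
      Tight-restriction⁻ : ∀ A B → (trace M A , trace M B) ∈ Tight restriction →
                           (A , B) ∈ Tight x
      Tight-restriction⁻ A B tight = +-cancelʳ (x ∅ + x ∅) _ _
        (trans (sym (decompose₂ A B))
          (trans (+-cong (trace-Tight⁺ {y = restriction} A B tight) (parts-tight A B))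
            (decompose₂ (A ∪ B) (A ∩ B))))

      -- The same sum of equations, with the one outside `M` cancelled instead of the constant.
      Tight-restriction⁺ : ∀ A B → (A , B) ∈ Tight x →
                           (trace M A , trace M B) ∈ Tight restriction
      Tight-restriction⁺ A B tight = trace-Tight⁻ {y = restriction} A B
        (+-cancelʳ (x (part (∁ M) A) + x (part (∁ M) B)) _ _
          (trans (decompose₂ A B) (trans (+-congʳ tight)
            (trans (sym (decompose₂ (A ∪ B) (A ∩ B))) (+-congˡ (sym (parts-tight A B)))))))

    -- The dichotomy for `m` is applied to the lifting of `y`. Its answer returns to `M` because
    -- every pair over `M` is the trace of a pair over `N`.
    OnExtremeRay⁻ : OnExtremeRay m → OnExtremeRay r
    OnExtremeRay⁻ (¬modular , dichotomy) =
      (λ modular → ¬modular λ (A , B) → Tight-m⁺ A B (modular (trace M A , trace M B))) , dichotomy′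
      where
      dichotomy′ : ∀ {y} → y ∈ 𝒦 M → Tight r ⊆ Tight y → Modular y ⊎ Tight y ⊆ Tight r
      dichotomy′ {y} y∈𝒦 r⊆y with dichotomy (trace-𝒦 {y = y} y∈𝒦)
        (λ {(A , B)} tight → trace-Tight⁺ {y = y} A B (r⊆y (Tight-m⁻ A B tight)))
      ... | inj₁ modular = inj₁ λ (A , B) → subst (Tight y) (traces≡ A B)
              (trace-Tight⁻ {y = y} (trace N A) (trace N B) (modular (trace N A , trace N B)))
      ... | inj₂ y⊆m = inj₂ λ {(A , B)} tight → Tight-r⁺ A B
              (y⊆m (trace-Tight⁺ {y = y} (trace N A) (trace N B)
                (subst (Tight y) (≡.sym (traces≡ A B)) tight)))

    -- The dichotomy for `r` is applied to the restriction of `x`, whose tight pairs determine those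
    -- of `x`.
    OnExtremeRay⁺ : OnExtremeRay r → OnExtremeRay m
    OnExtremeRay⁺ (¬modular , dichotomy) =
      (λ modular → ¬modular λ (A , B) → Tight-r⁺ A B (modular (trace N A , trace N B))) , dichotomy′
      where
      dichotomy′ : ∀ {x} → x ∈ 𝒦 N → Tight m ⊆ Tight x → Modular x ⊎ Tight x ⊆ Tight m
      dichotomy′ {x} x∈𝒦 m⊆x
        with dichotomy (trace-𝒦 {y = x} x∈𝒦) (Tight-r⊆restriction {x} m⊆x)
      ... | inj₁ modular = inj₁ λ (A , B) →
              Tight-restriction⁻ {x} m⊆x A B (modular (trace M A , trace M B))
      ... | inj₂ x⊆r     = inj₂ λ {(A , B)} tight →
              Tight-m⁺ A B (x⊆r (Tight-restriction⁺ {x} m⊆x A B tight))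

open import Data.Nat.Base using (_≤_)

corollary6 : ∀ {c ℓ₁ ℓ₂} (ℝ : CompleteOrderedField c ℓ₁ ℓ₂) →
    let open SetFunctions ℝ in
    {n : ℕ} (N M : Subset n) → 2 ≤ ∣ N ∣ → M ⊆ˢ N →
    (r : ℝ^𝒫 M) (m : ℝ^𝒫 N) → r ∈ 𝒦 M → m ∈ 𝒦 N → m IsLiftingOf r →
    m ∈ Extreme N ⇔ r ∈ Extreme M
corollary6 ℝ N M _ M⊆N r m r∈𝒦 m∈𝒦 lifting = mk⇔
  (OnExtremeRay⇒Extreme r∈𝒦 ∘ OnExtremeRay⁻ ∘ Extreme⇒OnExtremeRay)
  (OnExtremeRay⇒Extreme m∈𝒦 ∘ OnExtremeRay⁺ ∘ Extreme⇒OnExtremeRay)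
  where
  open SupermodularCone ℝ
  open Lifting M⊆N r m lifting
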